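{- Every positive tight program $P$ can be isomorphically represented by a cascade program product of reset programs; that is, there exist $k\ge1$, a finite nonempty set $\mathcal I_{\mathbf P}$ and a feedforward function $\psi_{\mathbf P}$ such that the product $\mathbf P=R\ltimes\dots\ltimes R\,[\mathcal I_{\mathbf P},\psi_{\mathbf P}]$ ($k$ factors, each the reset program $R$) satisfies $\Psi_P\in\mathbf I\mathbf S(\{\Psi_{\mathbf P}\})$.
   Context: Programs: a (normal logic) program $P$ over a finite nonempty set of atoms $\Gamma_P$ is a finite nonempty set of rules $a\leftarrow b_1,\dots,b_k,\mathrm{not}\,b_{k+1},\dots,\mathrm{not}\,b_m$ ($m\ge k\ge 0$, atoms in $\Gamma_P$); for such a rule $r$, $H(r)=a$, $B^+(r)=\{b_1,\dots,b_k\}$, $B^-(r)=\{b_{k+1},\dots,b_m\}$. $P$ is positive if $B^-(r)=\emptyset$ for every $r\in P$. $P$ is tight if there is a map $\ell:\Gamma_P\to\mathbb Z_{\ge0}$ with $\ell(H(r))>\ell(b)$ for every rule $r\in P$ and every $b\in B^+(r)$. $\mathcal I_P$ is the power set of $\Gamma_P$. $\Psi_P:\mathcal I_P\times\mathcal I_P\to\mathcal I_P$ is $\Psi_P(I,J)=\{H(r): r\in P,\ B^+(r)\subseteq I,\ B^-(r)\cap J=\emptyset\}$. The characteristic automaton of $P$ is $\langle \mathcal I_P,\mathcal I_P,\Psi_P\rangle$, also denoted $\Psi_P$. Reset program: $R$ over $\{1\}$ consists of the single rule $1\leftarrow\mathrm{not}\,1$ (so $\Psi_R(I,J)=\{1\}$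 if $J=\emptyset$ and $\emptyset$ otherwise). Automata: an automaton $\langle Q,\Sigma,\delta\rangle$ has finite state set $Q$, finite nonempty input alphabet $\Sigma$, and $\delta:Q\times\Sigma\to Q$. $\langle Q',\Sigma',\delta'\rangle$ is a subautomaton of $\langle Q,\Sigma,\delta\rangle$ if $Q'\subseteq Q$, $\Sigma'\subseteq\Sigma$, $\delta(Q'\times\Sigma')\subseteq Q'$ and $\delta'=\delta|_{Q'\times\Sigma'}$. An isomorphism onto $\langle Q',\Sigma',\delta'\rangle$ is a pair of bijections $h_1:Q\to Q'$, $h_2:\Sigma\to\Sigma'$ with $h_1(\delta(q,x))=\delta'(h_1(q),h_2(x))$ for all $q,x$. $\mathbf S(\mathcal A)$, $\mathbf I(\mathcal A)$ denote the classes of subautomata and isomorphic images of automata in $\mathcal A$. Cascade program product: let $P_1,\dots,P_k$ ($k\ge1$) be programs and $\mathcal I_{\mathbf P}$ a finite nonempty set. A feedforward function is $\psi_{\mathbf P}=(\psi_{\mathbf P,1},\dots,\psi_{\mathbf P,k})$ with $\psi_{\mathbf P,i}:(\mathcal I_{P_1}\times\dots\times\mathcal I_{P_k})\times\mathcal I_{\mathbf P}\to\mathcal I_{P_i}$ not depending on its $j$-th component for any $j\ge i$. The product $\mathbf P=P_1\ltimes\dots\ltimes P_k[\mathcal I_{\mathbf P},\psi_{\mathbf P}]$ has characteristic automaton $\Psi_{\mathbf P}=\langle \mathcal I_{P_1}\times\dots\times\mathcal I_{P_k},\ \mathcal I_{\mathbf P},\ \Psi_{\mathbf P}\rangle$ with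 $\Psi_{\mathbf P}((I_1,\dots,I_k),\mathbf J)=\big(\Psi_{P_1}(I_1,\psi_{\mathbf P,1}(\mathbf J)),\dots,\Psi_{P_k}(I_k,\psi_{\mathbf P,k}((I_1,\dots,I_{k-1}),\mathbf J))\big)$. The product isomorphically represents $P$ if $\Psi_P\in\mathbf I\mathbf S(\{\Psi_{\mathbf P}\})$. -}

module Defs where

open import Data.Bool using (Bool; true; false; T)
open import Data.Fin as Fin using (Fin; zero; suc)
import Data.Fin.Properties as Finₚ
open import Data.Fin.Subset using (Subset; _∈_; _⊆_; _∩_; Empty; ⊥; ⁅_⁆)
open import Data.Fin.Subset.Properties using (_⊆?_; nonempty?)
open import Data.List.Membership.Propositional using (find; lose) renaming (_∈_ to _∈ₗ_)
open import Data.List.NonEmpty using (List⁺; toList; [_])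
open import Data.List.Relation.Unary.Any using (Any; any?)
open import Data.Nat using (ℕ; zero; suc; _+_; _*_; _<_; NonZero)
open import Data.Product using (Σ-syntax; ∃-syntax; _×_; _,_; proj₁)
open import Data.Product.Function.Dependent.Propositional using (Σ-↔)
open import Data.Product.Function.NonDependent.Propositional using (_×-↔_)
open import Data.Sum using (_⊎_; inj₁; inj₂)
open import Data.Sum.Function.Propositional using (_⊎-↔_)
open import Data.Unit using (tt) renaming (⊤ to Unit)
open import Data.Vec using ([]; _∷_; tabulate; lookup)
open import Data.Vec.Properties using (lookup∘tabulate; []=⇒lookup; lookup⇒[]=)
open import Function.Bundles using (_↔_; _⤖_; _⇔_; mk⇔; mk↔ₛ′; Inverse; Bijection)
open import Function.Properties.Inverse using (↔-refl; ↔-sym; ↔-trans)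
open import Level using (0ℓ) renaming (suc to lsuc)
open import Relation.Binary.PropositionalEquality using (_≡_; _≢_; refl; sym; trans)
open import Relation.Nullary using (Dec; ¬?; does; yes)
open import Relation.Nullary.Decidable using (_×-dec_; dec-true)
open import Relation.Unary using (Pred; ｛_｝) renaming (_∈_ to _∈ₚ_)

IsFinite : Set → Set
IsFinite A = ∃[ n ] (A ↔ Fin n)

record FiniteNonemptySet : Set₁ where
  field
    Carrier  : Set
    finite   : IsFinite Carrier
    nonempty : Carrier

open FiniteNonemptySet using (Carrier)

finite-↔ : ∀ {A B : Set} → A ↔ B → IsFinite B → IsFinite A
finite-↔ A↔B (n , B↔n) = n , ↔-trans A↔B B↔n

finite-× : ∀ {A B : Set} → IsFinite A → IsFinite B → IsFinite (A × B)
finite-× (m , A↔m) (n , B↔n) = m * n , ↔-trans (A↔m ×-↔ B↔n) (↔-sym Finₚ.*↔×)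

finite-⊎ : ∀ {A B : Set} → IsFinite A → IsFinite B → IsFinite (A ⊎ B)
finite-⊎ (m , A↔m) (n , B↔n) = m + n , ↔-trans (A↔m ⊎-↔ B↔n) (↔-sym Finₚ.+↔⊎)

finite-Subset : ∀ n → IsFinite (Subset n)
finite-Subset zero    = 1 , mk↔ₛ′ (λ _ → zero) (λ _ → []) (λ { zero → refl }) (λ { [] → refl })
finite-Subset (suc n) = finite-↔ uncons↔ (finite-× (2 , ↔-sym Finₚ.2↔Bool) (finite-Subset n))
  where
  uncons↔ : Subset (suc n) ↔ (Bool × Subset n)
  uncons↔ = mk↔ₛ′ (λ { (x ∷ xs) → x , xs }) (λ (x , xs) → x ∷ xs)
                  (λ _ → refl) (λ { (_ ∷ _) → refl })

-- The elements of the subset of A with characteristic function χ.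
⟪_⟫ : {A : Set} → (A → Bool) → Set
⟪_⟫ {A} χ = Σ[ a ∈ A ] T (χ a)

finite-T : ∀ b → IsFinite (T b)
finite-T true  = 1 , ↔-sym Finₚ.1↔⊤
finite-T false = 0 , ↔-sym Finₚ.0↔⊥

finite-⟪Fin⟫ : ∀ n (χ : Fin n → Bool) → IsFinite ⟪ χ ⟫
finite-⟪Fin⟫ zero    χ = 0 , mk↔ₛ′ proj₁ (λ ()) (λ ()) (λ ())
finite-⟪Fin⟫ (suc n) χ =
  finite-↔ split (finite-⊎ (finite-T (χ zero)) (finite-⟪Fin⟫ n (λ i → χ (suc i))))
  where
  split : ⟪ χ ⟫ ↔ (T (χ zero) ⊎ ⟪ (λ i → χ (suc i)) ⟫)
  split = mk↔ₛ′ (λ { (zero , t) → inj₁ t ; (suc i , t) → inj₂ (i , t) })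
                (λ { (inj₁ t) → zero , t ; (inj₂ (i , t)) → suc i , t })
                (λ { (inj₁ _) → refl ; (inj₂ _) → refl })
                (λ { (zero , _) → refl ; (suc _ , _) → refl })

finite-⟪⟫ : ∀ {A : Set} → IsFinite A → (χ : A → Bool) → IsFinite ⟪ χ ⟫
finite-⟪⟫ {A} (n , A↔n) χ = finite-↔ (↔-sym ⟪Fin⟫↔⟪A⟫) (finite-⟪Fin⟫ n (λ i → χ (from i)))
  where
  open Inverse A↔n using (from)
  ⟪Fin⟫↔⟪A⟫ : ⟪ (λ i → χ (from i)) ⟫ ↔ ⟪ χ ⟫
  ⟪Fin⟫↔⟪A⟫ = Σ-↔ (↔-sym A↔n) ↔-refl

-- F 0 × ⋯ × F (k - 1).  Used instead of (i : Fin k) → F i because, without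
-- function extensionality, propositional equality of functions is too fine.
Tuple : ∀ {k} → (Fin k → Set) → Set
Tuple {zero}  F = Unit
Tuple {suc k} F = F zero × Tuple (λ i → F (suc i))

component : ∀ {k} {F : Fin k → Set} → Tuple F → (i : Fin k) → F i
component (x , _)  zero    = x
component (_ , xs) (suc i) = component xs i

tuple : ∀ {k} {F : Fin k → Set} → ((i : Fin k) → F i) → Tuple F
tuple {zero}  f = tt
tuple {suc k} f = f zero , tuple (λ i → f (suc i))

finite-Tuple : ∀ {k} {F : Fin k → Set} → (∀ i → IsFinite (F i)) → IsFinite (Tuple F)
finite-Tuple {zero}  fin = 1 , ↔-sym Finₚ.1↔⊤
finite-Tuple {suc k} fin = finite-× (fin zero) (finite-Tuple (λ i → fin (suc i)))

record Automaton : Set₁ where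
  field
    Q       : Set
    finiteQ : IsFinite Q
    Alph    : FiniteNonemptySet
    δ       : Q → Carrier Alph → Q

  Letter : Set
  Letter = Carrier Alph

-- The data determining a subautomaton of A; subsets of the finite sets of
-- states and letters are given by characteristic functions.
record Sub (A : Automaton) : Set where
  open Automaton A
  field
    Q′        : Q → Bool
    Σ′        : Letter → Bool
    nonemptyΣ : ⟪ Σ′ ⟫
    closed    : ∀ q x → T (Q′ q) → T (Σ′ x) → T (Q′ (δ q x))

subautomaton : (A : Automaton) → Sub A → Automaton
subautomaton A S = record
  { Q       = ⟪ Q′ ⟫
  ; finiteQ = finite-⟪⟫ finiteQ Q′
  ; Alph    = record
    { Carrier  = ⟪ Σ′ ⟫
    ; finite   = finite-⟪⟫ (FiniteNonemptySet.finite Alph) Σ′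
    ; nonempty = nonemptyΣ
    }
  ; δ       = λ (q , q∈Q′) (x , x∈Σ′) → δ q x , closed q x q∈Q′ x∈Σ′
  }
  where
  open Automaton A
  open Sub S

record Isomorphism (A B : Automaton) : Set where
  private
    module A = Automaton A
    module B = Automaton B
  field
    h₁ : A.Q ⤖ B.Q
    h₂ : A.Letter ⤖ B.Letter
    homomorphic : ∀ q x → Bijection.to h₁ (A.δ q x) ≡ B.δ (Bijection.to h₁ q) (Bijection.to h₂ x)

𝐒 : Pred Automaton (lsuc 0ℓ) → Pred Automaton (lsuc 0ℓ)
𝐒 𝒜 B = ∃[ A ] (A ∈ₚ 𝒜 × Σ[ S ∈ Sub A ] subautomaton A S ≡ B)

𝐈 : Pred Automaton (lsuc 0ℓ) → Pred Automaton (lsuc 0ℓ)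
𝐈 𝒜 B = ∃[ A ] (A ∈ₚ 𝒜 × Isomorphism A B)

record Rule (n : ℕ) : Set where
  field
    H  : Fin n
    B⁺ : Subset n
    B⁻ : Subset n

open Rule public

-- The atoms are Fin #atoms.  The set of rules is listed; order and
-- repetitions are immaterial, since only membership is ever used.
record Program : Set where
  field
    #atoms        : ℕ
    nonemptyAtoms : NonZero #atoms
    rules         : List⁺ (Rule #atoms)

  Atom : Set
  Atom = Fin #atoms

open Program public using (#atoms; Atom)

infix 4 _∈ᵣ_
_∈ᵣ_ : ∀ {n} → Rule n → List⁺ (Rule n) → Set
r ∈ᵣ rs = r ∈ₗ toList rs

Positive : Program → Set
Positive P = ∀ r → r ∈ᵣ Program.rules P → B⁻ r ≡ ⊥

Tight : Program → Set
Tight P = Σ[ ℓ ∈ (Atom P → ℕ) ] (∀ r → r ∈ᵣ Program.rules P → ∀ b → b ∈ B⁺ r → ℓ b < ℓ (H r))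

𝓘 : Program → Set
𝓘 P = Subset (#atoms P)

-- r witnesses that a belongs to Ψ_P(I, J).
Fires : ∀ {n} → Subset n → Subset n → Fin n → Rule n → Set
Fires I J a r = H r ≡ a × B⁺ r ⊆ I × Empty (B⁻ r ∩ J)

fires? : ∀ {n} (I J : Subset n) (a : Fin n) (r : Rule n) → Dec (Fires I J a r)
fires? I J a r = (H r Fin.≟ a) ×-dec (B⁺ r ⊆? I) ×-dec ¬? (nonempty? (B⁻ r ∩ J))

Ψ : (P : Program) → 𝓘 P → 𝓘 P → 𝓘 P
Ψ P I J = tabulate λ a → does (any? (fires? I J a) (toList (Program.rules P)))

does-true⇒ : ∀ {A : Set} (A? : Dec A) → does A? ≡ true → A
does-true⇒ (yes a) _ = a

∈Ψ⇔ : ∀ P I J a → a ∈ Ψ P I J ⇔ (∃[ r ] (r ∈ᵣ Program.rules P × Fires I J a r))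
∈Ψ⇔ P I J a = mk⇔ (λ a∈Ψ → find (does-true⇒ fired? (trans (sym lk) ([]=⇒lookup a∈Ψ))))
                  (λ (r , r∈P , f) → lookup⇒[]= a _ (trans lk (dec-true fired? (lose r∈P f))))
  where
  fired? : Dec (Any (Fires I J a) (toList (Program.rules P)))
  fired? = any? (fires? I J a) (toList (Program.rules P))

  lk : lookup (Ψ P I J) a ≡ does fired?
  lk = lookup∘tabulate _ a

𝓘-alphabet : Program → FiniteNonemptySet
𝓘-alphabet P = record { Carrier = 𝓘 P ; finite = finite-Subset (#atoms P) ; nonempty = ⊥ }

charAutomaton : Program → Automaton
charAutomaton P = record
  { Q       = 𝓘 P
  ; finiteQ = finite-Subset (#atoms P)
  ; Alph    = 𝓘-alphabet P
  ; δ       = Ψ P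
  }

-- The single rule 1 ← not 1; the atom 1 is the element zero of Fin 1.
R : Program
R = record
  { #atoms        = 1
  ; nonemptyAtoms = _
  ; rules         = [ record { H = zero ; B⁺ = ⊥ ; B⁻ = ⁅ zero ⁆ } ]
  }

Ψ-R-∅ : ∀ I → Ψ R I ⊥ ≡ ⁅ zero ⁆
Ψ-R-∅ (true  ∷ []) = refl
Ψ-R-∅ (false ∷ []) = refl

Ψ-R-1 : ∀ I → Ψ R I ⁅ zero ⁆ ≡ ⊥
Ψ-R-1 (true  ∷ []) = refl
Ψ-R-1 (false ∷ []) = refl

Independent : ∀ {k} {F : Fin k → Set} {B : Set} → Fin k → (Tuple F → B) → Set
Independent {k} j f =
  ∀ s t → (∀ l → l ≢ j → component s l ≡ component t l) → f s ≡ f t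

record Feedforward {k} (Ps : Fin k → Program) (𝓙 : FiniteNonemptySet) : Set where
  field
    ψ           : (i : Fin k) → Tuple (λ j → 𝓘 (Ps j)) → Carrier 𝓙 → 𝓘 (Ps i)
    feedforward : ∀ i j → i Fin.≤ j → ∀ J → Independent j (λ s → ψ i s J)

cascadeAutomaton : ∀ {k} (Ps : Fin k → Program) (𝓙 : FiniteNonemptySet) → Feedforward Ps 𝓙 → Automaton
cascadeAutomaton Ps 𝓙 ff = record
  { Q       = Tuple (λ i → 𝓘 (Ps i))
  ; finiteQ = finite-Tuple (λ i → finite-Subset (#atoms (Ps i)))
  ; Alph    = 𝓙
  ; δ       = λ s J → tuple (λ i → Ψ (Ps i) (component s i) (ψ i s J))
  }
  where open Feedforward ff

record CascadeProduct : Set₁ where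
  constructor ⋉
  field
    {k}     : ℕ
    k≥1     : 0 < k
    factors : Fin k → Program
    inputs  : FiniteNonemptySet
    ff      : Feedforward factors inputs

Ψᶜ : CascadeProduct → Automaton
Ψᶜ 𝐏 = cascadeAutomaton factors inputs ff
  where open CascadeProduct 𝐏

_IsomorphicallyRepresents_ : CascadeProduct → Program → Set₁
𝐏 IsomorphicallyRepresents P = charAutomaton P ∈ₚ 𝐈 (𝐒 ｛ Ψᶜ 𝐏 ｝)

{-# OPTIONS --safe #-}

-- Enumerate the atoms in order of nondecreasing level.  By tightness, whether
-- an atom belongs to Ψ_P(I, J) depends, besides J, only on the atoms of I of
-- strictly smaller level, all of which come earlier in this enumeration.  A
-- reset program stores whichever bit it is fed, independently of its state, so
-- one reset program per atom, fed with that atom's next value, forms a cascade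
-- whose characteristic automaton is Ψ_P up to the reordering of the atoms.
module Submission where

open import Defs
open import Data.Bool using (true; false; not)
open import Data.Bool.Properties using (⇔→≡)
open import Data.Fin as Fin using (Fin; zero; suc; punchIn)
open import Data.Fin.Permutation using (Permutation′; _⟨$⟩ʳ_; _⟨$⟩ˡ_; inverseʳ; inverseˡ; insert; insert-punchIn) renaming (id to idₚ)
open import Data.Fin.Subset using (Subset)
open import Data.Nat using (ℕ; zero; suc; _≤_; _<_; s≤s; >-nonZero⁻¹)
open import Data.Nat.Properties using (≤-refl; ≤-trans; ≤-total; <⇒≱)
open import Data.Product using (Σ-syntax; ∃-syntax; _,_; proj₁)
open import Data.Sum using (inj₁; inj₂)
open import Data.Unit using (tt)
open import Data.Vec using ([]; _∷_; head; tabulate; lookup)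
open import Data.Vec.Properties using (lookup∘tabulate; tabulate∘lookup; tabulate-cong; []=⇒lookup; lookup⇒[]=)
open import Function.Base using (_∘_)
open import Function.Bundles using (_↔_; mk↔ₛ′; mk⇔; Equivalence)
open import Function.Properties.Inverse using (↔-trans; ↔⇒⤖)
open import Relation.Binary.PropositionalEquality using (_≡_; _≢_; refl; sym; trans; cong; cong₂; subst; module ≡-Reasoning)
open import Relation.Nullary using (contradiction)

component-tuple : ∀ {k} {F : Fin k → Set} (f : ∀ i → F i) i → component {F = F} (tuple f) i ≡ f i
component-tuple f zero    = refl
component-tuple f (suc i) = component-tuple (f ∘ suc) i

component-injective : ∀ {k} {F : Fin k → Set} (s t : Tuple F) →
  (∀ i → component s i ≡ component t i) → s ≡ t
component-injective {zero}  _        _        _  = refl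
component-injective {suc k} (_ , xs) (_ , ys) eq =
  cong₂ _,_ (eq zero) (component-injective xs ys (eq ∘ suc))

argmin : ∀ {n} (f : Fin (suc n) → ℕ) → ∃[ a ] (∀ b → f a ≤ f b)
argmin {zero}  f = zero , λ { zero → ≤-refl }
argmin {suc n} f with argmin (f ∘ suc)
... | a , fa≤ with ≤-total (f zero) (f (suc a))
... | inj₁ f0≤fa = zero , λ { zero → ≤-refl ; (suc b) → ≤-trans f0≤fa (fa≤ b) }
... | inj₂ fa≤f0 = suc a , λ { zero → fa≤f0 ; (suc b) → fa≤ b }

-- Selection sort: a minimiser `a` of `f` is sent to the front, and the remaining indices, reached
-- through `punchIn a`, are sorted recursively.
sortingPermutation : ∀ {n} (f : Fin n → ℕ) →
  Σ[ π ∈ Permutation′ n ] (∀ i j → i Fin.≤ j → f (π ⟨$⟩ʳ i) ≤ f (π ⟨$⟩ʳ j))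
sortingPermutation {zero}  f = idₚ , λ ()
sortingPermutation {suc n} f with argmin f
... | a , fa≤ with sortingPermutation (f ∘ punchIn a)
... | π , π-mono = insert zero a π , mono
  where
  mono : ∀ i j → i Fin.≤ j → f (insert zero a π ⟨$⟩ʳ i) ≤ f (insert zero a π ⟨$⟩ʳ j)
  mono zero    j       _         = fa≤ _
  mono (suc i) (suc j) (s≤s i≤j)
    rewrite insert-punchIn zero a π i | insert-punchIn zero a π j = π-mono i j i≤j

-- By tightness the positive body of a rule with head `a` lies strictly below the level of `a`,
-- where `I` and `I′` agree; so the same rules for `a` fire.
Ψ-local : (P : Program) ((ℓ , _) : Tight P) (J I I′ : 𝓘 P) (a : Atom P) →
  (∀ b → ℓ b < ℓ a → lookup I b ≡ lookup I′ b) →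
  lookup (Ψ P I J) a ≡ lookup (Ψ P I′ J) a
Ψ-local P (ℓ , tight) J I I′ a agree =
  ⇔→≡ (mk⇔ (transfer I I′ agree) (transfer I′ I λ b b<a → sym (agree b b<a)))
  where
  transfer : ∀ I I′ → (∀ b → ℓ b < ℓ a → lookup I b ≡ lookup I′ b) →
    lookup (Ψ P I J) a ≡ true → lookup (Ψ P I′ J) a ≡ true
  transfer I I′ agree a∈ with Equivalence.to (∈Ψ⇔ P I J a) (lookup⇒[]= a _ a∈)
  -- Matching `refl` identifies `a` with `H r`, so that `tight` bounds the levels of `B⁺ r` by that
  -- of `a`.
  ... | r , r∈P , refl , B⁺⊆I , B⁻∩J=∅ =
    []=⇒lookup (Equivalence.from (∈Ψ⇔ P I′ J a)
      (r , r∈P , refl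
         , (λ {b} b∈B⁺ → lookup⇒[]= b I′
             (trans (sym (agree b (tight r r∈P b b∈B⁺))) ([]=⇒lookup (B⁺⊆I b∈B⁺))))
         , B⁻∩J=∅))

Ψ-R-not : ∀ I b → Ψ R I (not b ∷ []) ≡ b ∷ []
Ψ-R-not I true  = Ψ-R-∅ I
Ψ-R-not I false = Ψ-R-1 I

-- For a permutation π enumerating the atoms, the i-th component of a state
-- holds the membership bit of the atom π i.
unpack : ∀ {n} → Permutation′ n → Tuple {n} (λ _ → 𝓘 R) → Subset n
unpack π s = tabulate λ a → head (component s (π ⟨$⟩ˡ a))

pack : ∀ {n} → Permutation′ n → Subset n → Tuple {n} (λ _ → 𝓘 R)
pack π I = tuple λ i → lookup I (π ⟨$⟩ʳ i) ∷ []

unpack-pack : ∀ {n} (π : Permutation′ n) I → unpack π (pack π I) ≡ I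
unpack-pack π I = trans (tabulate-cong bit) (tabulate∘lookup I)
  where
  bit : ∀ a → head (component (pack π I) (π ⟨$⟩ˡ a)) ≡ lookup I a
  bit a = trans (cong head (component-tuple _ (π ⟨$⟩ˡ a))) (cong (lookup I) (inverseʳ π))

pack-unpack : ∀ {n} (π : Permutation′ n) s → pack π (unpack π s) ≡ s
pack-unpack π s = component-injective _ _ λ i → begin
  component (pack π (unpack π s)) i                  ≡⟨ component-tuple _ i ⟩
  lookup (unpack π s) (π ⟨$⟩ʳ i) ∷ []                ≡⟨ cong (_∷ []) (lookup∘tabulate _ (π ⟨$⟩ʳ i)) ⟩
  head (component s (π ⟨$⟩ˡ (π ⟨$⟩ʳ i))) ∷ []        ≡⟨ cong (λ j → head (component s j) ∷ []) (inverseˡ π) ⟩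
  head (component s i) ∷ []                          ≡⟨ head-∷ (component s i) ⟩
  component s i                                      ∎
  where
  open ≡-Reasoning
  head-∷ : (I : 𝓘 R) → head I ∷ [] ≡ I
  head-∷ (_ ∷ []) = refl

unpack↔ : ∀ {n} → Permutation′ n → Tuple {n} (λ _ → 𝓘 R) ↔ Subset n
unpack↔ π = mk↔ₛ′ (unpack π) (pack π) (unpack-pack π) (pack-unpack π)

⟪true⟫↔ : ∀ {A : Set} → ⟪ (λ (_ : A) → true) ⟫ ↔ A
⟪true⟫↔ = mk↔ₛ′ proj₁ (_, tt) (λ _ → refl) (λ _ → refl)

-- The inputs are computed from the whole decoded state; independence of the components from `i` on
-- is recovered from `Ψ-local` and the monotonicity of `π`.
resetFeedforward : (P : Program) ((ℓ , _) : Tight P) (π : Permutation′ (#atoms P)) →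
  (∀ i j → i Fin.≤ j → ℓ (π ⟨$⟩ʳ i) ≤ ℓ (π ⟨$⟩ʳ j)) →
  Feedforward {#atoms P} (λ _ → R) (𝓘-alphabet P)
resetFeedforward P tight@(ℓ , _) π π-mono = record
  -- The bit is negated because R holds 1 exactly after reading ∅.
  { ψ           = λ i s J → not (lookup (Ψ P (unpack π s) J) (π ⟨$⟩ʳ i)) ∷ []
  ; feedforward = λ i j i≤j J s t s≈t →
      cong (λ b → not b ∷ []) (Ψ-local P tight J _ _ (π ⟨$⟩ʳ i) (agree i j i≤j s t s≈t))
  }
  where
  agree : ∀ i j → i Fin.≤ j → (s t : Tuple {#atoms P} (λ _ → 𝓘 R)) →
    (∀ l → l ≢ j → component s l ≡ component t l) →
    ∀ b → ℓ b < ℓ (π ⟨$⟩ʳ i) → lookup (unpack π s) b ≡ lookup (unpack π t) b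
  agree i j i≤j s t s≈t b b<i = begin
    lookup (unpack π s) b              ≡⟨ lookup∘tabulate _ b ⟩
    head (component s (π ⟨$⟩ˡ b))      ≡⟨ cong head (s≈t (π ⟨$⟩ˡ b) earlier) ⟩
    head (component t (π ⟨$⟩ˡ b))      ≡⟨ lookup∘tabulate _ b ⟨
    lookup (unpack π t) b              ∎
    where
    open ≡-Reasoning
    earlier : π ⟨$⟩ˡ b ≢ j
    -- If `b` sat at position `j`, which is at or after `i`, sortedness would put its level at or
    -- above that of the atom at `i`, against `b<i`.
    earlier refl = contradiction
      (subst (λ c → ℓ (π ⟨$⟩ʳ i) ≤ ℓ c) (inverseʳ π) (π-mono i j i≤j)) (<⇒≱ b<i)

theorem5p3 : (P : Program) → Positive P → Tight P →
    Σ[ k ∈ ℕ ] Σ[ k≥1 ∈ 1 ≤ k ] Σ[ 𝓙 ∈ FiniteNonemptySet ] Σ[ ψ ∈ Feedforward {k} (λ _ → R) 𝓙 ]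
      (⋉ k≥1 (λ _ → R) 𝓙 ψ) IsomorphicallyRepresents P
theorem5p3 P _ tight@(ℓ , _) with sortingPermutation ℓ
... | π , π-mono =
  #atoms P , k≥1 , 𝓘-alphabet P , ff
  , subautomaton A whole , (A , refl , whole , refl) , record
    { h₁          = ↔⇒⤖ (↔-trans ⟪true⟫↔ (unpack↔ π))
    ; h₂          = ↔⇒⤖ ⟪true⟫↔
    ; homomorphic = λ (s , _) (J , _) → unpack-δ s J
    }
  where
  k≥1 : 1 ≤ #atoms P
  k≥1 = >-nonZero⁻¹ (#atoms P) {{Program.nonemptyAtoms P}}

  ff : Feedforward (λ _ → R) (𝓘-alphabet P)
  ff = resetFeedforward P tight π π-mono

  A : Automaton
  A = Ψᶜ (⋉ k≥1 (λ _ → R) (𝓘-alphabet P) ff)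

  whole : Sub A
  whole = record
    { Q′        = λ _ → true
    ; Σ′        = λ _ → true
    ; nonemptyΣ = FiniteNonemptySet.nonempty (𝓘-alphabet P) , tt
    ; closed    = λ _ _ _ _ → tt
    }

  unpack-δ : ∀ s J → unpack π (Automaton.δ A s J) ≡ Ψ P (unpack π s) J
  unpack-δ s J = trans (cong (unpack π) δ≡pack) (unpack-pack π _)
    where
    -- In each component the negation made by `R` cancels the one in its input, leaving the next bit
    -- of the corresponding atom.
    δ≡pack : Automaton.δ A s J ≡ pack π (Ψ P (unpack π s) J)
    δ≡pack = component-injective _ _ λ i →
      trans (component-tuple _ i) (trans (Ψ-R-not (component s i) _) (sym (component-tuple _ i)))
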